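{- Let $n,t,k\in\mathbb{N}$ be such that $n\ge 2$, $t\ge 3$, and $k<r(B_n,B_n)$. If there exists a $2$-coloring of the edges of $K_k$ that avoids a monochromatic $B_n$ and a monochromatic $K_{1,\lfloor \frac{n+k-1}{2}\rfloor+1}$, then $gr^t_2(B_{n+k})\ge 2k+1$.
   Context: $K_n$ is the complete graph of order $n$, and $K_{1,m}$ is the star with $m$ edges. The book $B_n:=K_2+nK_1$ (graph join) is the graph on $n+2$ vertices consisting of an edge $xy$ (the spine) together with $n$ further, pairwise non-adjacent vertices (the pages), each adjacent to both $x$ and $y$. $r(G_1,G_2)$ is the $2$-color Ramsey number: the least $p$ such that every $2$-coloring of the edges of $K_p$ contains, for some $i\in\{1,2\}$, a monochromatic copy of $G_i$ in color $i$. A $t$-coloring of $K_p$ is a map $f:E(K_p)\to\{1,\dots,t\}$, not assumed surjective. A Gallai $t$-coloring is a $t$-coloring with no rainbow triangle, i.e. there are no three vertices $x,y,z$ such that $f(xy),f(xz),f(yz)$ are pairwise distinct. For $1\le s<t$ and a graph $G$, the weakened Gallai-Ramsey number $gr^t_s(G)$ is the least $p\in\mathbb{N}$ such that every Gallai $t$-coloring of $K_p$ contains a (not necessarily induced) subgraph isomorphic to $G$ whose edges use at most $s$ colors. -}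

module Defs where

open import Data.Empty using (⊥)
open import Data.Fin using (Fin; zero; suc)
open import Data.Fin.Subset using (Subset; _∈_; ∣_∣)
open import Data.Nat using (ℕ; _≤_)
open import Data.Product using (Σ; ∃-syntax; _×_)
open import Data.Sum using (_⊎_; inj₁; inj₂)
open import Data.Unit using (⊤; tt)
open import Function.Definitions using (Injective)
open import Relation.Binary.Definitions using (Symmetric; Irreflexive)
open import Relation.Binary.PropositionalEquality using (_≡_; _≢_; refl; ≢-sym)
open import Relation.Nullary using (¬_)

record Graph : Set₁ where
  field
    V      : Set
    Adj    : V → V → Set
    sym    : Symmetric Adj
    irrefl : Irreflexive _≡_ Adj

open Graph public using (V; Adj)

complete : ℕ → Graph
complete n = record
  { V      = Fin n
  ; Adj    = _≢_
  ; sym    = ≢-sym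
  ; irrefl = λ x≡y x≢y → x≢y x≡y
  }

-- n K₁: n isolated vertices.
edgeless : ℕ → Graph
edgeless n = record
  { V      = Fin n
  ; Adj    = λ _ _ → ⊥
  ; sym    = λ ()
  ; irrefl = λ _ ()
  }

join : Graph → Graph → Graph
join G H = record
  { V      = V G ⊎ V H
  ; Adj    = adj
  ; sym    = λ {x} {y} → adj-sym x y
  ; irrefl = λ {x} → adj-irrefl x
  }
  where
  adj : V G ⊎ V H → V G ⊎ V H → Set
  adj (inj₁ x) (inj₁ y) = Adj G x y
  adj (inj₁ _) (inj₂ _) = ⊤
  adj (inj₂ _) (inj₁ _) = ⊤
  adj (inj₂ x) (inj₂ y) = Adj H x y

  adj-sym : ∀ x y → adj x y → adj y x
  adj-sym (inj₁ _) (inj₁ _) e = Graph.sym G e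
  adj-sym (inj₁ _) (inj₂ _) _ = tt
  adj-sym (inj₂ _) (inj₁ _) _ = tt
  adj-sym (inj₂ _) (inj₂ _) e = Graph.sym H e

  adj-irrefl : ∀ x {y} → x ≡ y → ¬ adj x y
  adj-irrefl (inj₁ _) refl = Graph.irrefl G refl
  adj-irrefl (inj₂ _) refl = Graph.irrefl H refl

book : ℕ → Graph
book n = join (complete 2) (edgeless n)

-- K₁,ₘ, with the single vertex of the first factor as centre.
star : ℕ → Graph
star m = join (edgeless 1) (edgeless m)

-- A t-coloring of the edges of K_p.  An edge is an unordered pair of distinct
-- vertices, hence the symmetry; the values on the diagonal carry no meaning
-- and are never consulted below.
record Coloring (t p : ℕ) : Set where
  field
    color     : Fin p → Fin p → Fin t
    color-sym : ∀ x y → color x y ≡ color y x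

open Coloring public

-- A (not necessarily induced) copy of G in K_p; any injection of vertices
-- preserves adjacency, because K_p is complete.
record Copy (G : Graph) (p : ℕ) : Set where
  field
    embed     : V G → Fin p
    injective : Injective _≡_ _≡_ embed

open Copy public

Monochromatic : ∀ {t p G} → Coloring t p → Fin t → Copy G p → Set
Monochromatic {G = G} f i c =
  ∀ u v → Adj G u v → color f (embed c u) (embed c v) ≡ i

HasMonochromatic : ∀ {t p} → Graph → Coloring t p → Fin t → Set
HasMonochromatic {p = p} G f i = Σ (Copy G p) (Monochromatic f i)

Avoids : ∀ {t p} → Coloring t p → Graph → Set
Avoids f G = ∀ i → ¬ HasMonochromatic G f i

UsesAtMost : ∀ {t p G} → ℕ → Coloring t p → Copy G p → Set
UsesAtMost {t} {G = G} s f c =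
  Σ (Subset t) λ S → ∣ S ∣ ≤ s ×
    (∀ u v → Adj G u v → color f (embed c u) (embed c v) ∈ S)

RainbowTriangle : ∀ {t p} → Coloring t p → Set
RainbowTriangle f =
  ∃[ x ] ∃[ y ] ∃[ z ]
    (x ≢ y × x ≢ z × y ≢ z) ×
    (color f x y ≢ color f x z ×
     color f x y ≢ color f y z ×
     color f x z ≢ color f y z)

Gallai : ∀ {t p} → Coloring t p → Set
Gallai f = ¬ RainbowTriangle f

IsLeast : (ℕ → Set) → ℕ → Set
IsLeast P m = P m × (∀ q → P q → m ≤ q)

-- Ramsey-type numbers are described by their defining property rather than as
-- functions: IsRamsey G₁ G₂ r says "r(G₁,G₂) = r".  Such an r is unique, and it
-- exists for finite graphs by Ramsey's theorem.
IsRamsey : Graph → Graph → ℕ → Set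
IsRamsey G₁ G₂ = IsLeast λ p → (f : Coloring 2 p) →
  HasMonochromatic G₁ f zero ⊎ HasMonochromatic G₂ f (suc zero)

-- IsGallaiRamsey t s G g says "gr^t_s(G) = g"; meant for 1 ≤ s < t.
IsGallaiRamsey : ℕ → ℕ → Graph → ℕ → Set
IsGallaiRamsey t s G = IsLeast λ p → (f : Coloring t p) → Gallai f →
  Σ (Copy G p) (UsesAtMost s f)

{-# OPTIONS --safe #-}
-- Colour two disjoint copies of the given colouring of K_k by two colours and
-- all edges between the copies by a third one; this colouring of K_{2k} is
-- Gallai.  Suppose it contains a copy of B_{n+k} in at most two colours.  If
-- the spine lies in one copy of K_k, then some page lies in the other copy and
-- at least n pages lie in the same one.  If the spine crosses, then at least
-- half of the pages lie in one of the copies.  Either way the third colour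
-- occurs, so only one further colour is left, in which those pages form a B_n,
-- respectively a star around an end of the spine.
module Submission where

open import Data.Empty using (⊥; ⊥-elim)
open import Data.Fin using (Fin; zero; suc; _↑ˡ_; _≟_)
open import Data.Fin.Properties
  using (suc-injective; injective⇒≤; inject≤-injective; *↔×)
open import Data.Fin.Subset using (Subset; _∈_; ∣_∣)
open import Data.Fin.Subset.Properties using (_∈?_)
open import Data.Nat using (ℕ; zero; suc; _+_; _*_; _∸_; _≤_; _<_; _≥_; ⌊_/2⌋; z≤n; s≤s; s≤s⁻¹)
open import Data.Nat.Properties
  using (≤-trans; ≤-reflexive; <-irrefl; ≮⇒≥; +-comm; +-suc; +-monoʳ-≤;
         ⌊n/2⌋≤⌈n/2⌉; ⌊n/2⌋+⌈n/2⌉≡n)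
open import Data.Product using (Σ; Σ-syntax; ∃-syntax; _×_; _,_; proj₁; proj₂)
open import Data.Sum as Sum using (_⊎_; inj₁; inj₂)
open import Data.Sum.Function.Propositional using (_⊎-↣_)
open import Data.Sum.Properties using (inj₂-injective)
open import Data.Unit using (tt)
open import Data.Vec using (here; there)
open import Function using (_∘_; case_of_; _↣_; mk↣; Injection)
open import Function.Construct.Composition using (_↣-∘_)
open import Function.Construct.Identity using (↣-id)
open import Function.Definitions using (Injective)
open import Function.Properties.Inverse using (Inverse⇒Injection)
open import Relation.Binary.PropositionalEquality
  using (_≡_; _≢_; refl; sym; trans; cong; cong₂; subst)
open import Relation.Nullary using (¬_; yes; no; contradiction)
open import Defs

open Injection using (to) renaming (injective to to-injective)

-- Kept as an injection rather than a subset, so that selected pages compose directly with the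
-- embedding of the book.
Selection : ∀ {N} → (Fin N → Set) → ℕ → Set
Selection {N} P a = Σ[ ι ∈ (Fin a ↣ Fin N) ] (∀ i → P (to ι i))

select-none : ∀ {N} (P : Fin N → Set) → Selection P 0
select-none _ = mk↣ {to = λ ()} (λ { {()} }) , λ ()

select-later : ∀ {N a} (P : Fin (suc N) → Set) →
  Selection (P ∘ suc) a → Selection P a
select-later _ (ι , p) = mk↣ (to-injective ι ∘ suc-injective) , p

select-first : ∀ {N a} (P : Fin (suc N) → Set) →
  P zero → Selection (P ∘ suc) a → Selection P (suc a)
select-first {N} {a} P p₀ (ι , p) = mk↣ {to = ι′} inj , p′
  where
  ι′ : Fin (suc a) → Fin (suc N)
  ι′ zero    = zero
  ι′ (suc i) = suc (to ι i)

  inj : Injective _≡_ _≡_ ι′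
  inj {zero}  {zero}  _ = refl
  inj {suc _} {suc _} e = cong suc (to-injective ι (suc-injective e))

  p′ : ∀ i → P (ι′ i)
  p′ zero    = p₀
  p′ (suc i) = p i

-- If both selections failed, at most `a - 1` indices would satisfy `P` and at most `b - 1` would
-- satisfy `Q`, too few to cover all `N`. The induction inspects index `zero` and lowers the demand
-- that it meets.
pigeonhole-⊎ : ∀ {N} a b {P Q : Fin N → Set} → a + b ≤ suc N →
  (∀ i → P i ⊎ Q i) → Selection P a ⊎ Selection Q b
pigeonhole-⊎ zero b {P} _ _ = inj₁ (select-none P)
pigeonhole-⊎ (suc a) zero {_} {Q} _ _ = inj₂ (select-none Q)
pigeonhole-⊎ {zero} (suc a) (suc b) le _ rewrite +-suc a b with s≤s () ← le
pigeonhole-⊎ {suc N} (suc a) (suc b) {P} {Q} le d with d zero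
... | inj₁ p = Sum.map (select-first P p) (select-later Q)
  (pigeonhole-⊎ a (suc b) (s≤s⁻¹ le) (d ∘ suc))
... | inj₂ q = Sum.map (select-later P) (select-first Q q)
  (pigeonhole-⊎ (suc a) b (s≤s⁻¹ (subst (_≤ suc (suc N)) (+-suc (suc a) b) le)) (d ∘ suc))

two-values : {a b : Fin 2} → a ≢ b → ∀ c → c ≡ a ⊎ c ≡ b
two-values {zero}     {zero}     a≢b _          = contradiction refl a≢b
two-values {suc zero} {suc zero} a≢b _          = contradiction refl a≢b
two-values {zero}     {suc zero} _   zero       = inj₁ refl
two-values {zero}     {suc zero} _   (suc zero) = inj₂ refl
two-values {suc zero} {zero}     _   zero       = inj₂ refl
two-values {suc zero} {zero}     _   (suc zero) = inj₁ refl

other : (a : Fin 2) → ∃[ b ] a ≢ b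
other zero       = suc zero , λ ()
other (suc zero) = zero , λ ()

first-three-∉ : ∀ {t} {S : Subset (3 + t)} → ∣ S ∣ ≤ 2 →
  zero ∈ S → suc zero ∈ S → ¬ suc (suc zero) ∈ S
first-three-∉ (s≤s (s≤s ())) here (there here) (there (there here))

module TwoCopies {k} (f : Coloring 2 k) (t : ℕ) where

  Vertex : Set
  Vertex = Fin 2 × Fin k

  cross : Fin (3 + t)
  cross = zero

  -- The shift by one keeps these, the colours 1 and 2, apart from `cross`.
  inner : Fin 2 → Fin (3 + t)
  inner i = suc (i ↑ˡ t)

  colour : Vertex → Vertex → Fin (3 + t)
  colour (a , x) (b , y) with a ≟ b
  ... | yes _ = inner (color f x y)
  ... | no  _ = cross

  colour-inner : ∀ {u v} → proj₁ u ≡ proj₁ v →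
    colour u v ≡ inner (color f (proj₂ u) (proj₂ v))
  colour-inner {a , _} {b , _} a≡b with a ≟ b
  ... | yes _   = refl
  ... | no  a≢b = contradiction a≡b a≢b

  colour-cross : ∀ {u v} → proj₁ u ≢ proj₁ v → colour u v ≡ cross
  colour-cross {a , _} {b , _} a≢b with a ≟ b
  ... | yes a≡b = contradiction a≡b a≢b
  ... | no  _   = refl

  colour-sym : ∀ u v → colour u v ≡ colour v u
  colour-sym (a , x) (b , y) with a ≟ b | b ≟ a
  ... | yes _   | yes _   = cong inner (color-sym f x y)
  ... | no  _   | no  _   = refl
  ... | yes a≡b | no  b≢a = contradiction (sym a≡b) b≢a
  ... | no  a≢b | yes b≡a = contradiction (sym b≡a) a≢b

  -- Either all three vertices share a side, where only two colours are available, or two of the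
  -- edges cross and have the same colour.
  not-rainbow : ∀ u v w → colour u v ≢ colour u w →
    colour u v ≢ colour v w → ¬ colour u w ≢ colour v w
  not-rainbow u@(a , x) v@(b , y) w@(c , z) with a ≟ b | a ≟ c | b ≟ c
  ... | yes _    | no _     | no _     = λ _ _ r → r refl
  ... | no _     | yes _    | no _     = λ _ q _ → q refl
  ... | no _     | no _     | _        = λ p _ _ → p refl
  -- Sharing a side is transitive, so a single crossing edge is impossible.
  ... | yes refl | yes refl | no b≢c   = contradiction refl b≢c
  ... | yes refl | no a≢c   | yes refl = contradiction refl a≢c
  ... | no a≢b   | yes refl | yes refl = contradiction refl a≢b
  ... | yes _    | yes _    | yes _    = λ p q r →
    case (two-values (p ∘ cong inner) (color f y z)) of λ
      { (inj₁ e) → q (cong inner (sym e)) ; (inj₂ e) → r (cong inner (sym e)) }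

  -- `cross` takes one of the at most two places in `S`, which leaves room for a single inner
  -- colour.
  dominant-colour : ∀ {S : Subset (3 + t)} → ∣ S ∣ ≤ 2 → cross ∈ S →
    ∃[ i ] (∀ j → inner j ∈ S → j ≡ i)
  dominant-colour {S} S≤2 c∈S with inner zero ∈? S
  ... | yes 0∈S = zero , λ
    { zero _ → refl
    ; (suc zero) 1∈S → contradiction 1∈S (first-three-∉ S≤2 c∈S 0∈S) }
  -- A default: this colour need not lie in `S`, but it is the only candidate left.
  ... | no 0∉S = suc zero , λ
    { zero 0∈S → contradiction 0∈S 0∉S
    ; (suc zero) _ → refl }

  module _ {A : Set} (e : A ↣ Vertex) {a} (on-side : ∀ v → proj₁ (to e v) ≡ a) where

    position : A ↣ Fin k
    position = mk↣ {to = proj₂ ∘ to e} λ {u} {v} eq →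
      to-injective e (cong₂ _,_ (trans (on-side u) (sym (on-side v))) eq)

  overfull : ∀ {a} (e : Fin (suc k) ↣ Vertex) → ¬ (∀ v → proj₁ (to e v) ≡ a)
  overfull e on-side = <-irrefl refl (injective⇒≤ (to-injective (position e on-side)))

  -- The common end of both cases: inside one side only the dominant inner colour survives, and it
  -- is a colour of `f` itself.
  monochromatic-part : ∀ {H} (e : V H ↣ Vertex) {a} → (∀ v → proj₁ (to e v) ≡ a) →
    {S : Subset (3 + t)} → ∣ S ∣ ≤ 2 → cross ∈ S →
    (∀ u v → Adj H u v → colour (to e u) (to e v) ∈ S) →
    ¬ Avoids f H
  monochromatic-part e on-side {S} S≤2 c∈S uses avoids =
    let i , dominant = dominant-colour S≤2 c∈S in
    avoids i
      ( record { embed = to pos ; injective = to-injective pos }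
      , λ u v uv → dominant _
          (subst (_∈ S) (colour-inner (trans (on-side u) (sym (on-side v)))) (uses u v uv)))
    where pos = position e on-side

  module _ {n m : ℕ} (n≥1 : n ≥ 1) (2m≤ : m + m ≤ suc (n + k))
    (no-book : Avoids f (book n)) (no-star : Avoids f (star m))
    (e : V (book (n + k)) ↣ Vertex) {S : Subset (3 + t)} (S≤2 : ∣ S ∣ ≤ 2)
    (uses : ∀ u v → Adj (book (n + k)) u v → colour (to e u) (to e v) ∈ S)
    where

    private
      side : V (book (n + k)) → Fin 2
      side v = proj₁ (to e v)

      spine : Fin 2 → V (book (n + k))
      spine = inj₁

      page : Fin (n + k) ↣ V (book (n + k))
      page = mk↣ {to = inj₂} inj₂-injective

    -- There are at least `k + 1` pages, and a side holds only `k` vertices.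
    some-page-off : ∀ {a b} → a ≢ b → ∃[ j ] side (inj₂ j) ≡ b
    some-page-off a≢b
      with pigeonhole-⊎ (suc k) 1
             (s≤s (≤-trans (+-monoʳ-≤ k n≥1) (≤-reflexive (+-comm k n))))
             (two-values a≢b ∘ side ∘ inj₂)
    ... | inj₁ (ι , on-a) = ⊥-elim (overfull (e ↣-∘ (page ↣-∘ ι)) on-a)
    ... | inj₂ (ι , on-b) = to ι zero , on-b zero

    -- The opposite side takes at most `k` of the `n + k` pages.
    many-pages-on : ∀ {a b} → a ≢ b → Selection (λ j → side (inj₂ j) ≡ a) n
    many-pages-on a≢b
      with pigeonhole-⊎ n (suc k) (≤-reflexive (+-suc n k)) (two-values a≢b ∘ side ∘ inj₂)
    ... | inj₁ s          = s
    ... | inj₂ (ι , on-b) = ⊥-elim (overfull (e ↣-∘ (page ↣-∘ ι)) on-b)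

    spine-crosses : ¬ side (spine zero) ≡ side (spine (suc zero))
    spine-crosses same =
      let b , a≢b  = other (side (spine zero))
          j , on-b = some-page-off a≢b
          ι , on-a = many-pages-on a≢b
          part = ↣-id (Fin 2) ⊎-↣ ι
      in monochromatic-part {H = book n} (e ↣-∘ part)
           (λ { (inj₁ zero) → refl ; (inj₁ (suc zero)) → sym same ; (inj₂ i) → on-a i })
           S≤2
           -- The edge from the spine to the page `j` on the other side puts `cross` into `S`.
           (subst (_∈ S) (colour-cross (λ eq → a≢b (trans eq on-b))) (uses (spine zero) (inj₂ j) tt))
           (λ u v uv → uses (to part u) (to part v) (widen-adj ι u v uv)) no-book
      where
      widen-adj : ∀ (ι : Fin n ↣ Fin (n + k)) u v → Adj (book n) u v →
        Adj (book (n + k)) (to (↣-id (Fin 2) ⊎-↣ ι) u) (to (↣-id (Fin 2) ⊎-↣ ι) v)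
      widen-adj ι (inj₁ _) (inj₁ _) uv = uv
      widen-adj ι (inj₁ _) (inj₂ _) _  = tt
      widen-adj ι (inj₂ _) (inj₁ _) _  = tt

    cross∈S : cross ∈ S
    cross∈S = subst (_∈ S) (colour-cross spine-crosses)
      (uses (spine zero) (spine (suc zero)) λ ())

    -- One end of the spine and the pages beside it form a star within a single side, even though
    -- the spine crosses.
    no-crossing-star : ∀ i →
      ¬ Selection (λ j → side (inj₂ j) ≡ side (spine i)) m
    no-crossing-star i (ι , on-side) =
      monochromatic-part {H = star m} (e ↣-∘ part)
        (λ { (inj₁ zero) → refl ; (inj₂ j) → on-side j }) S≤2 cross∈S
        (λ u v uv → uses (to part u) (to part v) (part-adj u v uv)) no-star
      where
      part : V (star m) ↣ V (book (n + k))
      part = mk↣ {to = λ _ → i} (λ { {zero} {zero} _ → refl }) ⊎-↣ ι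

      part-adj : ∀ u v → Adj (star m) u v → Adj (book (n + k)) (to part u) (to part v)
      part-adj (inj₁ _) (inj₂ _) _ = tt
      part-adj (inj₂ _) (inj₁ _) _ = tt

    no-book-in-two-colours : ⊥
    no-book-in-two-colours
      -- The ends of the spine occupy both sides, so every page lies beside one of them.
      with pigeonhole-⊎ m m 2m≤ (two-values spine-crosses ∘ side ∘ inj₂)
    ... | inj₁ s = no-crossing-star zero s
    ... | inj₂ s = no-crossing-star (suc zero) s

-- With `suc n` pages, this is the bound under which `pigeonhole-⊎` finds a whole star beside one
-- end of the spine.
half+half≤ : ∀ n → (⌊ n /2⌋ + 1) + (⌊ n /2⌋ + 1) ≤ suc (suc n)
half+half≤ n rewrite +-comm ⌊ n /2⌋ 1 | +-suc ⌊ n /2⌋ ⌊ n /2⌋ =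
  s≤s (s≤s (≤-trans (+-monoʳ-≤ ⌊ n /2⌋ (⌊n/2⌋≤⌈n/2⌉ n)) (≤-reflexive (⌊n/2⌋+⌈n/2⌉≡n n))))

theorem2p7 : (n t k : ℕ) → n ≥ 2 → t ≥ 3 →
    (r : ℕ) → IsRamsey (book n) (book n) r → k < r →
    (Σ (Coloring 2 k) λ f → Avoids f (book n) × Avoids f (star (⌊ n + k ∸ 1 /2⌋ + 1))) →
    (g : ℕ) → IsGallaiRamsey t 2 (book (n + k)) g → g ≥ 2 * k + 1
theorem2p7 (suc n) (suc (suc (suc t))) k n≥2 (s≤s (s≤s (s≤s _))) _ _ _
  (f , no-book , no-star) g (forces , _) = ≮⇒≥ λ g<2k+1 →
    let g≤2k = s≤s⁻¹ (subst (suc g ≤_) (+-comm (2 * k) 1) g<2k+1)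

        -- `K_g` sits inside the doubled colouring on `2 * k` vertices and inherits the absence of
        -- rainbow triangles.
        place : Fin g ↣ Vertex
        place = Inverse⇒Injection *↔× ↣-∘ mk↣ (inject≤-injective g≤2k g≤2k _ _)

        F : Coloring (3 + t) g
        F = record
          { color     = λ x y → colour (to place x) (to place y)
          ; color-sym = λ x y → colour-sym (to place x) (to place y)
          }

        c , S , S≤2 , uses = forces F λ
          { (x , y , z , _ , p , q , r) →
            not-rainbow (to place x) (to place y) (to place z) p q r }
    -- After matching on `suc n`, the index `suc n + k ∸ 1` in the star reduces to `n + k`.
    in no-book-in-two-colours (≤-trans (s≤s z≤n) n≥2) (half+half≤ (n + k)) no-book no-star
         (place ↣-∘ mk↣ (injective c)) S≤2 uses
  where open TwoCopies f t
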